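{- The class of $(\overline{2P_1+P_2},\,3P_1+P_2)$-free graphs has bounded clique-width.
   Context: All graphs are finite, simple and undirected. For graphs $H_1,\dots,H_p$, a graph $G$ is $(H_1,\dots,H_p)$-free if no induced subgraph of $G$ is isomorphic to any $H_i$. $P_r$ denotes the path on $r$ vertices; $G+H$ is the disjoint union of $G$ and $H$, and $rG$ is the disjoint union of $r$ copies of $G$; $\overline{G}$ is the complement of $G$. Thus $\overline{2P_1+P_2}$ is the diamond (the graph obtained from $K_4$ by deleting one edge). The clique-width of a graph $G$ is the minimum number of labels needed to construct $G$ using the operations: (1) create a single vertex with label $i$; (2) take the disjoint union of two labelled graphs; (3) add all edges between vertices with label $i$ and vertices with label $j$ ($i\ne j$); (4) rename label $i$ to $j$. A class of graphs has bounded clique-width if there is a constant $c$ such that every graph in the class has clique-width at most $c$. -}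

module Defs where

open import Data.Nat using (ℕ; zero; suc; _+_; _∸_; _≡ᵇ_)
open import Data.Fin using (Fin; toℕ; splitAt) renaming (_≟_ to _≟ᶠ_)
open import Data.Bool using (Bool; true; false; _∧_; _∨_; not)
open import Data.Sum using (_⊎_; inj₁; inj₂)
open import Data.Product using (Σ; ∃; _×_; _,_)
open import Relation.Binary.PropositionalEquality using (_≡_)
open import Relation.Nullary using (¬_)
open import Relation.Nullary.Decidable using (⌊_⌋)
open import Function.Definitions using (Injective)
open import Function.Bundles using (_↔_; Inverse)

Graph : ℕ → Set
Graph n = Fin n → Fin n → Bool

record Simple {n : ℕ} (G : Graph n) : Set where
  field
    sym     : ∀ i j → G i j ≡ G j i
    irrefl  : ∀ i → G i i ≡ false

_==_ : ∀ {n} → Fin n → Fin n → Bool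
i == j = ⌊ i ≟ᶠ j ⌋

P : (r : ℕ) → Graph r
P r i j = ((toℕ i ∸ toℕ j) ≡ᵇ 1) ∨ ((toℕ j ∸ toℕ i) ≡ᵇ 1)

co : ∀ {n} → Graph n → Graph n
co G i j = not (G i j) ∧ not (i == j)

_⊕_ : ∀ {m n} → Graph m → Graph n → Graph (m + n)
_⊕_ {m} G H x y with splitAt m x | splitAt m y
... | inj₁ a | inj₁ b = G a b
... | inj₂ a | inj₂ b = H a b
... | _      | _      = false

copies : ∀ (r : ℕ) {n} → Graph n → Graph (Data.Nat._*_ r n)
copies zero    G = λ ()
copies (suc r) G = G ⊕ copies r G

InducedSub : ∀ {m n} → Graph m → Graph n → Set
InducedSub {m} {n} H G =
  Σ (Fin m → Fin n) λ f → Injective _≡_ _≡_ f × (∀ i j → H i j ≡ G (f i) (f j))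

Free : ∀ {m n} → Graph m → Graph n → Set
Free H G = ¬ InducedSub H G

-- k-expressions (clique-width operations with labels Fin k), indexed by
-- the number of vertices of the graph they build.  The constructor ∅
-- (the empty graph) only serves to give the null graph clique-width 0.
data Expr (k : ℕ) : ℕ → Set where
  ∅      : Expr k zero
  vertex : Fin k → Expr k 1
  union  : ∀ {m n} → Expr k m → Expr k n → Expr k (m + n)
  join   : ∀ {n} (i j : Fin k) → ¬ (i ≡ j) → Expr k n → Expr k n
  rename : ∀ {n} (i j : Fin k) → Expr k n → Expr k n

label : ∀ {k n} → Expr k n → Fin n → Fin k
label (vertex i) _ = i
label (union {m} e₁ e₂) x with splitAt m x
... | inj₁ a = label e₁ a
... | inj₂ b = label e₂ b
label (join _ _ _ e) x = label e x
label (rename i j e) x with label e x == i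
... | true  = j
... | false = label e x

edge : ∀ {k n} → Expr k n → Graph n
edge ∅ ()
edge (vertex _) _ _ = false
edge (union {m} e₁ e₂) = edge e₁ ⊕ edge e₂
edge (join i j _ e) x y =
  edge e x y ∨ ((label e x == i ∧ label e y == j) ∨ (label e x == j ∧ label e y == i))
edge (rename _ _ e) x y = edge e x y

CwAtMost : ∀ {n} → ℕ → Graph n → Set
CwAtMost {n} k G =
  Σ (Expr k n) λ e → Σ (Fin n ↔ Fin n) λ π →
    ∀ x y → edge e x y ≡ G (Inverse.to π x) (Inverse.to π y)

diamond : Graph 4
diamond = co (copies 2 (P 1) ⊕ P 2)

3P₁+P₂ : Graph 5
3P₁+P₂ = copies 3 (P 1) ⊕ P 2

module Submission where

-- Suppose first that there is an independent set of size six.  A vertex with a neighbour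
-- in it misses at most two of its elements, so two such vertices have two common
-- neighbours in it and are non-adjacent: the graph is bipartite, and apart from isolated
-- vertices its bipartite complement has maximum degree two.
-- Otherwise Ramsey's theorem yields a 5-clique among any large number of vertices, and a
-- diamond-free graph extends it to a unique maximal clique, in which an outside vertex has
-- at most one neighbour.  Repeat this outside the cliques found so far.  Four 5-cliques
-- would give 3P₁ + P₂, so three maximal cliques cover all but boundedly many vertices, and
-- each covered vertex has at most two neighbours across.
-- In both cases the graph is, up to boundedly many vertices, a blow-up of a graph of
-- bounded size altered along a graph of maximum degree two, whose components are paths and
-- cycles.  Adding vertices along these components keeps the number of neighbourhoods in
-- the remaining vertices bounded, and hence the number of labels.

open import Defs
open import Data.Bool using (Bool; true; false; _∧_; _∨_)
import Data.Bool.Properties as Bool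
open import Data.Empty using (⊥; ⊥-elim)
open import Data.Fin
  using (Fin; zero; suc; _↑ˡ_; _↑ʳ_; splitAt; inject≤; combine; punchOut)
  renaming (_≟_ to _≟ᶠ_; _<_ to _<ᶠ_)
import Data.Fin.Properties as Fin
open import Data.Fin.Patterns using (0F; 1F; 2F; 3F; 4F)
open import Data.Fin.Permutation using (↔⇒≡)
open import Data.List using (List; []; _∷_; length; map; filter; allFin; _++_; lookup)
open import Data.List.Properties using (length-map; length-++; length-filter; filter-notAll)
open import Data.List.Membership.Propositional using (_∈_; _∉_; find)
open import Data.List.Membership.Propositional.Properties
  using (∈-allFin; ∈-filter⁺; ∈-filter⁻; ∈-map⁺; ∈-map⁻; ∈-++⁺ˡ; ∈-++⁺ʳ; ∈-++⁻)
open import Data.List.Relation.Unary.All as All using (All; []; _∷_)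
open import Data.List.Relation.Unary.All.Properties using (all-filter; ¬All⇒Any¬; ¬Any⇒All¬)
open import Data.List.Relation.Unary.Any as Any using (here; there; index)
open import Data.List.Relation.Unary.Any.Properties using (lookup-index)
open import Data.List.Relation.Unary.AllPairs using (AllPairs; []; _∷_)
import Data.List.Relation.Unary.AllPairs.Properties as AllPairs
open import Data.List.Relation.Unary.Unique.Propositional.Properties using (allFin⁺)
open import Data.Nat using (ℕ; zero; suc; _+_; _≤_; _<_; z≤n; s≤s; s≤s⁻¹)
import Data.Nat.Properties as ℕ
open import Data.Product using (Σ; ∃; _×_; _,_; proj₁; proj₂)
open import Data.Sum using (_⊎_; inj₁; inj₂)
open import Data.Vec.Functional using () renaming (_∷_ to _◂_)
open import Function using (_∘_; case_of_)
open import Function.Bundles using (_↔_; Inverse; mk↔ₛ′)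
open import Function.Definitions using (Injective)
open import Relation.Binary.PropositionalEquality
  using (_≡_; _≢_; refl; sym; trans; cong; cong₂; subst; ≢-sym)
open import Relation.Binary.Definitions using (tri<; tri≈; tri>)
open import Relation.Nullary using (¬_; Dec; yes; no; does; contradiction)
open import Relation.Nullary.Decidable using (_×-dec_; _⊎-dec_; ¬?; decidable-stable; from-yes)
open import Relation.Unary using (Decidable)

-- Counting in filtered lists.

true≢false : true ≢ false
true≢false ()

module _ {A : Set} {P : A → Set} (P? : Decidable P) {R : A → A → Set} where

  -- `R` holds what is known of two entries at different places, such as distinctness. Filtering
  -- preserves it, so two survivors would be contradictory.
  length-filter≤1 : ∀ {xs} → AllPairs R xs → (∀ {a b} → P a → P b → R a b → ⊥) →
    length (filter P? xs) ≤ 1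
  length-filter≤1 {xs} rs ¬two
    with filter P? xs | all-filter P? xs | AllPairs.filter⁺ P? rs
  ... | []         | _            | _            = z≤n
  ... | _ ∷ []     | _            | _            = s≤s z≤n
  ... | _ ∷ _ ∷ _  | pa ∷ pb ∷ _  | (r ∷ _) ∷ _  = ⊥-elim (¬two pa pb r)

  length-filter≤2 : ∀ {xs} → AllPairs R xs →
    (∀ {a b c} → P a → P b → P c → R a b → R a c → R b c → ⊥) →
    length (filter P? xs) ≤ 2
  length-filter≤2 {xs} rs ¬three
    with filter P? xs | all-filter P? xs | AllPairs.filter⁺ P? rs
  ... | []             | _                 | _ = z≤n
  ... | _ ∷ []         | _                 | _ = s≤s z≤n
  ... | _ ∷ _ ∷ []     | _                 | _ = s≤s (s≤s z≤n)
  ... | _ ∷ _ ∷ _ ∷ _  | pa ∷ pb ∷ pc ∷ _  | (rab ∷ rac ∷ _) ∷ (rbc ∷ _) ∷ _ =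
    ⊥-elim (¬three pa pb pc rab rac rbc)

length-filter-¬? : ∀ {A : Set} {P : A → Set} (P? : Decidable P) xs →
  length xs ≡ length (filter P? xs) + length (filter (¬? ∘ P?) xs)
length-filter-¬? P? []       = refl
length-filter-¬? P? (x ∷ xs) with P? x
... | yes _ = cong suc (length-filter-¬? P? xs)
... | no  _ = trans (cong suc (length-filter-¬? P? xs)) (sym (ℕ.+-suc _ _))

-- Relabelling and joining many labels at once

==-refl : ∀ {k} (i : Fin k) → (i == i) ≡ true
==-refl i with i ≟ᶠ i
... | yes _   = refl
... | no i≢i  = contradiction refl i≢i

==-≢ : ∀ {k} {i j : Fin k} → i ≢ j → (i == j) ≡ false
==-≢ {i = i} {j} i≢j with i ≟ᶠ j
... | yes i≡j = contradiction i≡j i≢j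
... | no _    = refl

edge-sym : ∀ {K n} (e : Expr K n) x y → edge e x y ≡ edge e y x
edge-sym (vertex _) _ _ = refl
edge-sym (union {m} e₁ e₂) x y with splitAt m x | splitAt m y
... | inj₁ a | inj₁ b = edge-sym e₁ a b
... | inj₁ _ | inj₂ _ = refl
... | inj₂ _ | inj₁ _ = refl
... | inj₂ a | inj₂ b = edge-sym e₂ a b
edge-sym (join i j _ e) x y = cong₂ _∨_ (edge-sym e x y)
  (trans (Bool.∨-comm (label e x == i ∧ label e y == j) _)
    (cong₂ _∨_ (Bool.∧-comm (label e x == j) _) (Bool.∧-comm (label e x == i) _)))
edge-sym (rename _ _ e) x y = edge-sym e x y

label-rename-≡ : ∀ {K n} {i j : Fin K} (e : Expr K n) x →
  label e x ≡ i → label (rename i j e) x ≡ j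
label-rename-≡ e x refl with label e x == label e x | ==-refl (label e x)
... | true | _ = refl

label-rename-≢ : ∀ {K n} {i j : Fin K} (e : Expr K n) x →
  label e x ≢ i → label (rename i j e) x ≡ label e x
label-rename-≢ {i = i} e x ≢i with label e x == i | ==-≢ ≢i
... | false | _ = refl

module Relabel {k K} (i j : Fin k → Fin K) where

  relabel : ∀ {n} → List (Fin k) → Expr K n → Expr K n
  relabel []       e = e
  relabel (a ∷ as) e = relabel as (rename (i a) (j a) e)

  edge-relabel : ∀ {n} as (e : Expr K n) x y → edge (relabel as e) x y ≡ edge e x y
  edge-relabel []       e x y = refl
  edge-relabel (a ∷ as) e x y = edge-relabel as _ x y

  label-relabel-other : ∀ {n} as (e : Expr K n) x → (∀ a → label e x ≢ i a) →
    label (relabel as e) x ≡ label e x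
  label-relabel-other []       e x ≢i = refl
  label-relabel-other (a ∷ as) e x ≢i = trans
    (label-relabel-other as _ x λ b eq → ≢i b (trans (sym step) eq)) step
    where step = label-rename-≢ e x (≢i a)

  -- The renames run one after another. As no target is a source, a label once moved stays put, so
  -- together they act simultaneously.
  label-relabel : (∀ {a b} → i a ≡ i b → a ≡ b) → (∀ a b → j a ≢ i b) →
    ∀ {n} as (e : Expr K n) x {a} → a ∈ as → label e x ≡ i a →
    label (relabel as e) x ≡ j a
  label-relabel i-inj j≢i (b ∷ as) e x {a} a∈ eq with a ≟ᶠ b | a∈
  ... | yes refl | _ = trans
    (label-relabel-other as _ x λ c eq′ → j≢i a c (trans (sym step) eq′)) step
    where step = label-rename-≡ e x eq
  ... | no a≢b | here a≡b  = contradiction a≡b a≢b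
  ... | no a≢b | there a∈′ = label-relabel i-inj j≢i as _ x a∈′
    (trans (label-rename-≢ e x λ eq′ → a≢b (i-inj (trans (sym eq) eq′))) eq)

module Joins {k K} (c : Fin K) (i : Fin k → Fin K) (c≢i : ∀ a → c ≢ i a)
  (i-inj : ∀ {a b} → i a ≡ i b → a ≡ b) (adj : Fin k → Bool) where

  -- The label `c` is meant for the new vertex, the image of `i` for the old ones.
  joins : ∀ {n} → List (Fin k) → Expr K n → Expr K n
  joins []       e = e
  joins (a ∷ as) e with adj a
  ... | true  = join c (i a) (c≢i a) (joins as e)
  ... | false = joins as e

  label-joins : ∀ {n} as (e : Expr K n) x → label (joins as e) x ≡ label e x
  label-joins []       e x = refl
  label-joins (a ∷ as) e x with adj a
  ... | true  = label-joins as e x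
  ... | false = label-joins as e x

  edge-joins-old : ∀ {n} as (e : Expr K n) x y → label e x ≢ c → label e y ≢ c →
    edge (joins as e) x y ≡ edge e x y
  edge-joins-old []       e x y x≢ y≢ = refl
  edge-joins-old (a ∷ as) e x y x≢ y≢ with adj a
  ... | false = edge-joins-old as e x y x≢ y≢
  ... | true
    rewrite label-joins as e x | label-joins as e y | ==-≢ x≢ | ==-≢ y≢
          | Bool.∧-zeroʳ (label e x == i a)
          = trans (Bool.∨-identityʳ _) (edge-joins-old as e x y x≢ y≢)

  edge-joins-diag : ∀ {n} as (e : Expr K n) x → label e x ≡ c →
    edge (joins as e) x x ≡ edge e x x
  edge-joins-diag []       e x _  = refl
  edge-joins-diag (a ∷ as) e x eq with adj a
  ... | false = edge-joins-diag as e x eq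
  ... | true
    rewrite label-joins as e x | eq | ==-≢ (c≢i a) | ==-refl c
          = trans (Bool.∨-identityʳ _) (edge-joins-diag as e x eq)

  edge-joins-new : ∀ {n} as (e : Expr K n) x y {b} → b ∈ as →
    label e x ≡ c → label e y ≡ i b → edge e x y ≡ false →
    edge (joins as e) x y ≡ adj b
  edge-joins-new {n} as e x y {b} b∈ ex ey e₀ = go as b∈
    where
    -- Each `a` that is really joined has `adj a` true, so it differs from `b` and its join leaves
    -- `y` alone.
    miss : ∀ as → adj b ≡ false → edge (joins as e) x y ≡ false
    miss []       _  = e₀
    miss (a ∷ as) ab with adj a in aa
    ... | false = miss as ab
    ... | true
      rewrite label-joins as e x | label-joins as e y | ex | ey | ==-refl c
            | ==-≢ {i = i b} {i a} (λ eq →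
                true≢false (trans (sym aa) (trans (cong adj (i-inj (sym eq))) ab)))
            | ==-≢ (c≢i a)
            = trans (Bool.∨-identityʳ _) (miss as ab)
    hit : ∀ as → b ∈ as → adj b ≡ true → edge (joins as e) x y ≡ true
    hit (a ∷ as) b∈ ab with b ≟ᶠ a | b∈
    ... | yes refl | _ rewrite ab | label-joins as e x | label-joins as e y | ex | ey
      | ==-refl c | ==-refl (i b) = Bool.∨-zeroʳ _
    ... | no b≢a | here b≡a = contradiction b≡a b≢a
    ... | no b≢a | there b∈′ with adj a
    ...   | false = hit as b∈′ ab
    ...   | true rewrite hit as b∈′ ab = refl
    go : ∀ as → b ∈ as → edge (joins as e) x y ≡ adj b
    go as b∈ with adj b in ab
    ... | true  = hit as b∈ ab
    ... | false = miss as ab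

↑ʳ≢↑ˡ : ∀ {m n} (a : Fin n) (b : Fin m) → m ↑ʳ a ≢ b ↑ˡ n
↑ʳ≢↑ˡ {m} {n} a b eq
  with () ← trans (sym (Fin.splitAt-↑ʳ m n a)) (trans (cong (splitAt m) eq) (Fin.splitAt-↑ˡ m b n))

-- Operations on expressions act on labels, so data given per vertex must be carried over to labels.
-- `d` is a filler for labels that no vertex bears.
representative : ∀ {j k} {B : Set} (ℓ : Fin j → Fin k) (g : Fin j → B) → B → Fin k → B
representative ℓ g d a with Fin.any? (λ x → ℓ x ≟ᶠ a)
... | yes (x , _) = g x
... | no _        = d

representative-spec : ∀ {j k} {B : Set} (ℓ : Fin j → Fin k) (g : Fin j → B) d x →
  ∃ λ y → ℓ y ≡ ℓ x × representative ℓ g d (ℓ x) ≡ g y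
representative-spec ℓ g d x with Fin.any? (λ y → ℓ y ≟ᶠ ℓ x)
... | yes (y , eq) = y , eq , refl
... | no ¬∃        = contradiction (x , refl) ¬∃

-- Building a graph vertex by vertex

module Linear {n} (G : Graph n) (simple : Simple G) where

  G-sym : ∀ x y → G x y ≡ G y x
  G-sym = Simple.sym simple

  Outside : ∀ {j} → (Fin j → Fin n) → Fin n → Set
  Outside f z = ∀ x → f x ≢ z

  Outside? : ∀ {j} (f : Fin j → Fin n) → Decidable (Outside f)
  Outside? f z = Fin.all? λ x → ¬? (f x ≟ᶠ z)

  -- The invariant of the construction: a vertex added later sees all or nothing of each label
  -- class, so joins by label can supply its edges.
  Faithful : ∀ {j k} → (Fin j → Fin n) → (Fin j → Fin k) → Set
  Faithful f ℓ = ∀ x y z → Outside f z → ℓ x ≡ ℓ y → G (f x) z ≡ G (f y) z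

  record Built k {j} (f : Fin j → Fin n) : Set where
    field
      expr     : Expr (k + k) j
      ℓ        : Fin j → Fin k
      faithful : Faithful f ℓ
      edges    : ∀ x y → edge expr x y ≡ G (f x) (f y)
      labels   : ∀ x → label expr x ≡ ℓ x ↑ˡ k

  built-∅ : ∀ {k} (f : Fin 0 → Fin n) → Built k f
  built-∅ f = record
    { expr = ∅ ; ℓ = λ () ; faithful = λ () ; edges = λ () ; labels = λ () }

  -- The second copy of the labels isolates the new vertex while it is joined, and
  -- serves as scratch space so that the relabelling σ is carried out simultaneously.
  -- The labelling ℓ′ need not refine ℓ; σ transports it to one that does.
  built-∷ : ∀ {k j} {f : Fin j → Fin n} {v} → Built k f → Outside f v →
    (ℓ′ : Fin (suc j) → Fin k) → Faithful (v ◂ f) ℓ′ → Built k (v ◂ f)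
  built-∷ {k} {j} {f} {v} B v∉ ℓ′ faithful′ = record
    { expr = e₄ ; ℓ = ℓ″ ; faithful = faithful″ ; edges = edges₄ ; labels = labels₄ }
    where
    open Built B
    σ   = representative ℓ (ℓ′ ∘ suc) (ℓ′ zero)
    adj = representative ℓ (λ x → G v (f x)) false
    c   = k ↑ʳ ℓ′ zero

    ℓ″ : Fin (suc j) → Fin k
    ℓ″ zero    = ℓ′ zero
    ℓ″ (suc x) = σ (ℓ x)

    -- `twin` passes to the position whose `ℓ′`-value defines `ℓ″`; by the old invariant this does
    -- not change the neighbours outside.
    faithful″ : Faithful (v ◂ f) ℓ″
    faithful″ x y z z∉ eq with twin x | twin y
      where
      twin : ∀ x → ∃ λ x′ → ℓ″ x ≡ ℓ′ x′ × G ((v ◂ f) x) z ≡ G ((v ◂ f) x′) z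
      twin zero    = zero , refl , refl
      twin (suc x) with representative-spec ℓ (ℓ′ ∘ suc) (ℓ′ zero) x
      ... | x′ , ℓ≡ , σ≡ = suc x′ , σ≡ , faithful x x′ z (z∉ ∘ suc) (sym ℓ≡)
    ... | x′ , ℓx , Gx | y′ , ℓy , Gy =
      trans Gx (trans (faithful′ x′ y′ z z∉ (trans (sym ℓx) (trans eq ℓy))) (sym Gy))

    -- This is the old invariant applied to the outside vertex `v` itself.
    adj-spec : ∀ x → adj (ℓ x) ≡ G v (f x)
    adj-spec x with representative-spec ℓ (λ x → G v (f x)) false x
    ... | y , ℓ≡ , eq = trans eq (trans (G-sym v (f y))
                          (trans (faithful y x v v∉ ℓ≡) (G-sym (f x) v)))

    module J  = Joins c (_↑ˡ k) (↑ʳ≢↑ˡ (ℓ′ zero)) (Fin.↑ˡ-injective k _ _) adj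
    module R₁ = Relabel (_↑ˡ k) (λ a → k ↑ʳ σ a)
    module R₂ = Relabel (k ↑ʳ_) (_↑ˡ k)

    e₁ e₂ e₃ e₄ : Expr (k + k) (suc j)
    e₁ = union (vertex c) expr
    e₂ = J.joins (allFin k) e₁
    e₃ = R₁.relabel (allFin k) e₂
    e₄ = R₂.relabel (allFin k) e₃

    old≢c : ∀ x → label expr x ≢ c
    old≢c x eq = ↑ʳ≢↑ˡ _ _ (trans (sym eq) (labels x))

    edges₂ : ∀ x y → edge e₂ x y ≡ G ((v ◂ f) x) ((v ◂ f) y)
    edges₂ zero    zero    = trans (J.edge-joins-diag (allFin k) e₁ zero refl)
                               (sym (Simple.irrefl simple v))
    edges₂ zero    (suc y) = trans
      (J.edge-joins-new (allFin k) e₁ zero (suc y) (∈-allFin (ℓ y)) refl (labels y) refl)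
      (adj-spec y)
    edges₂ (suc x) zero    = trans (edge-sym e₂ (suc x) zero)
      (trans (edges₂ zero (suc x)) (G-sym v (f x)))
    edges₂ (suc x) (suc y) = trans
      (J.edge-joins-old (allFin k) e₁ (suc x) (suc y) (old≢c x) (old≢c y)) (edges x y)

    edges₄ : ∀ x y → edge e₄ x y ≡ G ((v ◂ f) x) ((v ◂ f) y)
    edges₄ x y = trans (R₂.edge-relabel (allFin k) e₃ x y)
                   (trans (R₁.edge-relabel (allFin k) e₂ x y) (edges₂ x y))

    labels₃ : ∀ x → label e₃ x ≡ k ↑ʳ ℓ″ x
    labels₃ zero    = trans
      (R₁.label-relabel-other (allFin k) e₂ zero
        λ a eq → ↑ʳ≢↑ˡ _ _ (trans (sym (J.label-joins (allFin k) e₁ zero)) eq))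
      (J.label-joins (allFin k) e₁ zero)
    labels₃ (suc x) = R₁.label-relabel (Fin.↑ˡ-injective k _ _) (λ _ _ → ↑ʳ≢↑ˡ _ _)
      (allFin k) e₂ (suc x) (∈-allFin (ℓ x))
      (trans (J.label-joins (allFin k) e₁ (suc x)) (labels x))

    labels₄ : ∀ x → label e₄ x ≡ ℓ″ x ↑ˡ k
    labels₄ x = R₂.label-relabel (Fin.↑ʳ-injective k _ _) (λ _ _ → ≢-sym (↑ʳ≢↑ˡ _ _))
      (allFin k) e₃ x (∈-allFin (ℓ″ x)) (labels₃ x)

  -- `CwAtMost` wants exactly `n` vertices, while `j` is only provably equal to `n`. Matching while
  -- `j` is still a variable avoids transporting the expression.
  reindex : ∀ {K j} → j ≡ n → (e : Expr K j) (π : Fin j ↔ Fin n) →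
    (∀ x y → edge e x y ≡ G (Inverse.to π x) (Inverse.to π y)) → CwAtMost K G
  reindex refl e π edges = e , π , edges

  built⇒CwAtMost : ∀ {k j} {f : Fin j → Fin n} → Injective _≡_ _≡_ f → Built k f →
    (∀ z → ¬ Outside f z) → CwAtMost (k + k) G
  built⇒CwAtMost {f = f} inj B onto = reindex (↔⇒≡ π) (Built.expr B) π (Built.edges B)
    where
    preimage : ∀ z → ∃ λ x → f x ≡ z
    preimage z with Fin.any? (λ x → f x ≟ᶠ z)
    ... | yes p = p
    ... | no ¬p = contradiction (λ x eq → ¬p (x , eq)) (onto z)
    π : Fin _ ↔ Fin n
    π = mk↔ₛ′ f (proj₁ ∘ preimage) (proj₂ ∘ preimage) (λ x → inj (proj₂ (preimage (f x))))

  ◂-injective : ∀ {j} {f : Fin j → Fin n} {v} → Injective _≡_ _≡_ f → Outside f v →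
    Injective _≡_ _≡_ (v ◂ f)
  ◂-injective inj v∉ {zero}  {zero}  _  = refl
  ◂-injective inj v∉ {zero}  {suc y} eq = contradiction (sym eq) (v∉ y)
  ◂-injective inj v∉ {suc x} {zero}  eq = contradiction eq (v∉ x)
  ◂-injective inj v∉ {suc x} {suc y} eq = cong suc (inj eq)

-- Graphs at bounded distance from a degree-two graph

-- Up to the vertices of W, the graph differs from the pattern F ∘ t in a graph Exc of
-- maximum degree two.  The vertices outside W are added so that at every moment at most
-- two Exc-edges leave the set of vertices already added.
module NearPattern {n} (G : Graph n) (simple : Simple G)
  {T : Set} {m} (code : T → Fin m) (code-injective : ∀ {a b} → code a ≡ code b → a ≡ b)
  (t : Fin n → T) (F : T → T → Bool) (F-sym : ∀ a b → F a b ≡ F b a)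
  {r} (W : List (Fin n)) (W-short : length W ≤ r) where

  open Linear G simple
  open import Data.List.Membership.DecPropositional (_≟ᶠ_ {n}) using (_∈?_)

  Exc : Fin n → Fin n → Set
  Exc v w = v ∉ W × w ∉ W × v ≢ w × G v w ≢ F (t v) (t w)

  Exc? : ∀ v w → Dec (Exc v w)
  Exc? v w = ¬? (v ∈? W) ×-dec ¬? (w ∈? W) ×-dec ¬? (v ≟ᶠ w) ×-dec
    ¬? (G v w Bool.≟ F (t v) (t w))

  Exc-sym : ∀ {v w} → Exc v w → Exc w v
  Exc-sym {v} {w} (v∉ , w∉ , v≢w , G≢F) =
    w∉ , v∉ , ≢-sym v≢w , λ eq → G≢F (trans (G-sym v w) (trans eq (F-sym (t w) (t v))))

  -- Private labels: `r` for the vertices of `W` and two for the inner ends of the edges leaving the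
  -- prefix. The other `m` labels are for types.
  d = r + 2
  k = d + m

  -- Each vertex of `B` gets a label of its own. The others are labelled by type, which determines
  -- their neighbours outside.
  faithful-labelling : ∀ {j} (f : Fin j → Fin n) (B : List (Fin n)) → length B ≤ d →
    (∀ x z → f x ∉ B → Outside f z → G (f x) z ≡ F (t (f x)) (t z)) →
    Σ (Fin j → Fin k) (Faithful f)
  faithful-labelling {j} f B B-short typed = ℓ , faithful
    where
    lab : ∀ {v} → Dec (v ∈ B) → Fin k
    lab     (yes v∈B) = inject≤ (index v∈B) B-short ↑ˡ m
    lab {v} (no _)    = d ↑ʳ code (t v)
    ℓ : Fin j → Fin k
    ℓ x = lab (f x ∈? B)
    faithful : Faithful f ℓ
    faithful x y z z∉ eq with f x ∈? B | f y ∈? B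
    ... | yes x∈ | yes y∈ = cong (λ v → G v z) (trans (lookup-index x∈)
      (trans (cong (lookup B) (Fin.inject≤-injective _ _ _ _ (Fin.↑ˡ-injective m _ _ eq)))
        (sym (lookup-index y∈))))
    ... | yes _  | no _   = contradiction (sym eq) (↑ʳ≢↑ˡ _ _)
    ... | no _   | yes _  = contradiction eq (↑ʳ≢↑ˡ _ _)
    ... | no x∉  | no y∉  = trans (typed x z x∉ z∉)
      (trans (cong (λ a → F a (t z)) (code-injective (Fin.↑ʳ-injective d _ _ eq)))
        (sym (typed y z y∉ z∉)))

  record Prefix (j : ℕ) : Set where
    field
      f         : Fin j → Fin n
      injective : Injective _≡_ _≡_ f
      built     : Built k f

  -- With `W` placed first, every vertex still outside is subject to the pattern. The list may
  -- repeat vertices, so those already present are skipped.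
  build-W : ∀ ws → (∀ {w} → w ∈ ws → w ∈ W) → ∃ λ j → Σ (Prefix j) λ p →
    (∀ x → Prefix.f p x ∈ W) × (∀ {w} → w ∈ ws → ¬ Outside (Prefix.f p) w)
  build-W [] _ = 0 , record { f = λ () ; injective = λ {} ; built = built-∅ _ } , (λ ()) , λ ()
  build-W (w ∷ ws) ws⊆ with build-W ws (ws⊆ ∘ there)
  ... | j , p , f∈ , all with Outside? (Prefix.f p) w
  ...   | no ¬o = j , p , f∈ , λ { (here refl) → ¬o ; (there w∈) → all w∈ }
  ...   | yes o = suc j
    , record { f = f′ ; injective = ◂-injective injective o
             ; built = let ℓ , good = faithful-labelling f′ W (ℕ.≤-trans W-short (ℕ.m≤m+n r 2))
                                        (λ x _ x∉ _ → contradiction (f′∈ x) x∉)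
                       in built-∷ built o ℓ good }
    , f′∈
    , λ { (here refl) o′ → o′ zero refl ; (there w∈) o′ → all w∈ (o′ ∘ suc) }
    where
    open Prefix p
    f′ : Fin (suc j) → Fin n
    f′ = w ◂ f
    f′∈ : ∀ x → f′ x ∈ W
    f′∈ zero    = ws⊆ (here refl)
    f′∈ (suc x) = f∈ x

  module _ (degree≤2 : ∀ {v a b c} → Exc v a → Exc v b → Exc v c →
    a ≢ b → a ≢ c → b ≢ c → ⊥) where

    neighbours : Fin n → List (Fin n)
    neighbours v = filter (Exc? v) (allFin n)

    neighbours≤2 : ∀ v → length (neighbours v) ≤ 2
    neighbours≤2 v = length-filter≤2 (Exc? v) (allFin⁺ n) degree≤2

    -- In a pair of `cut` the inner end comes first. `complete` justifies labelling by type away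
    -- from the cut; `sound` makes the end of a cut edge a legitimate next vertex.
    record State (j : ℕ) : Set where
      field
        prefix : Prefix j
      open Prefix prefix public
      field
        cut      : List (Fin n × Fin n)
        cut≤2    : length cut ≤ 2
        sound    : ∀ {x z} → (x , z) ∈ cut → Exc z x × Outside f z × ∃ λ i → f i ≡ x
        complete : ∀ i z → Outside f z → Exc (f i) z → (f i , z) ∈ cut
        W-inside : ∀ {w} → w ∈ W → ¬ Outside f w

    module Extend {j} (s : State j) (v : Fin n) (v∉ : Outside (State.f s) v) where
      open State s

      f′ : Fin (suc j) → Fin n
      f′ = v ◂ f

      kept : List (Fin n × Fin n)
      kept = filter (λ e → ¬? (proj₂ e ≟ᶠ v)) cut

      forward : List (Fin n)
      forward = filter (Outside? f′) (neighbours v)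

      cut′ : List (Fin n × Fin n)
      cut′ = kept ++ map (v ,_) forward

      sound′ : ∀ {x z} → (x , z) ∈ cut′ → Exc z x × Outside f′ z × ∃ λ i → f′ i ≡ x
      sound′ xz∈ with ∈-++⁻ kept xz∈
      ... | inj₁ old with ∈-filter⁻ (λ e → ¬? (proj₂ e ≟ᶠ v)) {xs = cut} old
      ...   | xz∈cut , z≢v with sound xz∈cut
      ...     | exc , z∉ , i , eq =
        exc , (λ { zero → ≢-sym z≢v ; (suc y) → z∉ y }) , suc i , eq
      sound′ xz∈ | inj₂ new with ∈-map⁻ (v ,_) new
      ... | w , w∈ , refl with ∈-filter⁻ (Outside? f′) {xs = neighbours v} w∈
      ...   | w∈nbr , w∉ =
        Exc-sym (proj₂ (∈-filter⁻ (Exc? v) {xs = allFin n} w∈nbr)) , w∉ , zero , refl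

      complete′ : ∀ i z → Outside f′ z → Exc (f′ i) z → (f′ i , z) ∈ cut′
      complete′ zero    z z∉ exc = ∈-++⁺ʳ kept (∈-map⁺ (v ,_)
        (∈-filter⁺ (Outside? f′) (∈-filter⁺ (Exc? v) (∈-allFin z) exc) z∉))
      complete′ (suc i) z z∉ exc = ∈-++⁺ˡ
        (∈-filter⁺ (λ e → ¬? (proj₂ e ≟ᶠ v)) (complete i z (z∉ ∘ suc) exc) (≢-sym (z∉ zero)))

      extend : length cut′ ≤ 2 → State (suc j)
      extend cut′≤2 = record
        { prefix = record { f = f′ ; injective = ◂-injective injective v∉
                          ; built = built-∷ built v∉ (proj₁ labelling) (proj₂ labelling) }
        ; cut = cut′ ; cut≤2 = cut′≤2 ; sound = sound′ ; complete = complete′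
        ; W-inside = λ w∈ o → W-inside w∈ (o ∘ suc) }
        where
        boundary = W ++ map proj₁ cut′
        boundary≤d : length boundary ≤ d
        boundary≤d = subst (_≤ d) (sym (length-++ W)) (ℕ.+-mono-≤ W-short
          (subst (_≤ 2) (sym (length-map proj₁ cut′)) cut′≤2))
        -- A vertex off the boundary that deviates from the pattern at `z` would have a cut edge to
        -- `z`, hence lie on the boundary.
        labelling = faithful-labelling f′ boundary boundary≤d λ i z i∉ z∉ →
          decidable-stable (G (f′ i) z Bool.≟ F (t (f′ i)) (t z)) λ G≢F →
            i∉ (∈-++⁺ʳ W (∈-map⁺ proj₁ (complete′ i z z∉
              ( i∉ ∘ ∈-++⁺ˡ , (λ z∈W → W-inside z∈W (z∉ ∘ suc)) , z∉ i , G≢F))))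

      length-cut′ : length cut′ ≡ length kept + length forward
      length-cut′ = trans (length-++ kept) (cong (length kept +_) (length-map (v ,_) forward))

    -- Following a cut edge (x , v) removes it from the cut, and x from the forward
    -- neighbours of v.
    extend-along-cut : ∀ {j} (s : State j) v (v∉ : Outside (State.f s) v) →
      (State.cut s ≡ [] ⊎ ∃ λ x → ∃ λ es → State.cut s ≡ (x , v) ∷ es) → State (suc j)
    -- With an empty cut any `v` will do: only its own edges, at most two, enter the cut.
    extend-along-cut s v v∉ (inj₁ refl) = extend (subst (_≤ 2) (sym length-cut′)
        (ℕ.≤-trans (length-filter (Outside? f′) (neighbours v)) (neighbours≤2 v)))
      where open Extend s v v∉
    extend-along-cut s v v∉ (inj₂ (x , es , eq)) = extend (subst (_≤ 2) (sym length-cut′)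
        (ℕ.+-mono-≤ (s≤s⁻¹ kept<) (s≤s⁻¹ forward<)))
      where
      open Extend s v v∉
      open State s
      xv∈ : (x , v) ∈ cut
      xv∈ = subst ((x , v) ∈_) (sym eq) (here refl)
      kept< : length kept < 2
      kept< = ℕ.<-≤-trans (filter-notAll _ cut (Any.map (λ { refl ≢v → ≢v refl }) xv∈)) cut≤2
      forward< : length forward < 2
      forward< with sound xv∈
      ... | exc , _ , i , eq′ = ℕ.<-≤-trans (filter-notAll _ (neighbours v)
        (Any.map (λ { refl x∉ → x∉ (suc i) eq′ }) (∈-filter⁺ (Exc? v) (∈-allFin x) exc)))
        (neighbours≤2 v)

    -- The next vertex is the outer end of a cut edge if there is one, so a component of `Exc` is
    -- finished before another is begun. Fuel cannot run out, as an injective prefix has at most `n`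
    -- vertices.
    run : ∀ {j} fuel → n < fuel + j → State j → CwAtMost (k + k) G
    run zero n<j s = contradiction (Fin.injective⇒≤ (State.injective s)) (ℕ.<⇒≱ n<j)
    run {j} (suc fuel) n<j s = choose (State.cut s) refl
      where
      continue : ∀ v (v∉ : Outside (State.f s) v) →
        (State.cut s ≡ [] ⊎ ∃ λ x → ∃ λ es → State.cut s ≡ (x , v) ∷ es) → CwAtMost (k + k) G
      continue v v∉ c = run fuel (subst (n <_) (sym (ℕ.+-suc fuel j)) n<j)
                          (extend-along-cut s v v∉ c)
      choose : ∀ es → State.cut s ≡ es → CwAtMost (k + k) G
      choose ((x , v) ∷ es) eq = continue v
        (proj₁ (proj₂ (State.sound s (subst ((x , v) ∈_) (sym eq) (here refl)))))
        (inj₂ (x , es , eq))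
      choose [] eq with Fin.any? (Outside? (State.f s))
      ... | yes (v , v∉) = continue v v∉ (inj₁ eq)
      ... | no ¬o = built⇒CwAtMost (State.injective s) (State.built s) λ z o → ¬o (z , o)

    near-pattern⇒CwAtMost : CwAtMost (k + k) G
    near-pattern⇒CwAtMost with build-W W (λ w∈ → w∈)
    -- `Exc` avoids `W`, so the initial cut is empty.
    ... | j , p , f∈W , W-inside = run (suc n) (s≤s (ℕ.m≤m+n n j)) record
      { prefix = p ; cut = [] ; cut≤2 = z≤n ; sound = λ ()
      ; complete = λ i z _ exc → contradiction (f∈W i) (proj₁ exc) ; W-inside = W-inside }

-- The forbidden induced subgraphs

IsSymmetric? : ∀ {m} (H : Graph m) → Dec (∀ i j → H i j ≡ H j i)
IsSymmetric? H = Fin.all? λ i → Fin.all? λ j → H i j Bool.≟ H j i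

induced : ∀ {m n} {H : Graph m} {G : Graph n} → (∀ i j → H i j ≡ H j i) →
  (∀ i → H i i ≡ false) → Simple G → (f : Fin m → Fin n) →
  (∀ i j → i <ᶠ j → f i ≢ f j × H i j ≡ G (f i) (f j)) → InducedSub H G
induced {H = H} {G} H-sym H-irrefl simple f below = f , inj , edges
  where
  inj : Injective _≡_ _≡_ f
  inj {i} {j} eq with Fin.<-cmp i j
  ... | tri< i<j _ _ = contradiction eq (proj₁ (below i j i<j))
  ... | tri≈ _ i≡j _ = i≡j
  ... | tri> _ _ j<i = contradiction (sym eq) (proj₁ (below j i j<i))
  edges : ∀ i j → H i j ≡ G (f i) (f j)
  edges i j with Fin.<-cmp i j
  ... | tri< i<j _ _  = proj₂ (below i j i<j)
  ... | tri≈ _ refl _ = trans (H-irrefl i) (sym (Simple.irrefl simple (f i)))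
  ... | tri> _ _ j<i  = trans (H-sym i j) (trans (proj₂ (below j i j<i)) (Simple.sym simple _ _))

diamond-sym : ∀ i j → diamond i j ≡ diamond j i
diamond-sym = from-yes (IsSymmetric? diamond)

fork-sym : ∀ i j → 3P₁+P₂ i j ≡ 3P₁+P₂ j i
fork-sym = from-yes (IsSymmetric? 3P₁+P₂)

-- The first argument is for independent sets, the second for cliques. The successor counts the
-- vertex whose neighbours and non-neighbours are separated.
ramseyBound : ℕ → ℕ → ℕ
ramseyBound zero    _       = 0
ramseyBound (suc a) zero    = 0
ramseyBound (suc a) (suc b) = suc (ramseyBound (suc a) b + ramseyBound a (suc b))

module Forbidden {n} (G : Graph n) (simple : Simple G)
  (diamond-free : Free diamond G) (fork-free : Free 3P₁+P₂ G) where

  open Linear G simple using (G-sym)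

  _~_ _≁_ : Fin n → Fin n → Set
  x ~ y = G x y ≡ true
  x ≁ y = G x y ≡ false

  ~-sym : ∀ {x y} → x ~ y → y ~ x
  ~-sym = trans (G-sym _ _)

  ≁-sym : ∀ {x y} → x ≁ y → y ≁ x
  ≁-sym = trans (G-sym _ _)

  ~⇒≢ : ∀ {x y} → x ~ y → x ≢ y
  ~⇒≢ {x} xy refl = true≢false (trans (sym xy) (Simple.irrefl simple x))

  ~≁⇒≢ : ∀ {x y z} → x ~ y → x ≁ z → y ≢ z
  ~≁⇒≢ xy xz refl = true≢false (trans (sym xy) xz)

  ¬~⇒≁ : ∀ {x y} → ¬ (x ~ y) → x ≁ y
  ¬~⇒≁ = Bool.¬-not

  -- `x` and `y` are the vertices of degree three. Only `u` and `w` need an explicit inequality, the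
  -- other pairs being adjacent.
  no-diamond : ∀ {x y u w} → x ~ y → x ~ u → x ~ w → y ~ u → y ~ w → u ≁ w → u ≢ w → ⊥
  no-diamond {x} {y} {u} {w} xy xu xw yu yw uw u≢w =
    diamond-free (induced diamond-sym (λ { 0F → refl ; 1F → refl ; 2F → refl ; 3F → refl })
      simple f below)
    where
    f : Fin 4 → Fin n
    f = x ◂ y ◂ u ◂ w ◂ λ ()
    below : ∀ i j → i <ᶠ j → f i ≢ f j × diamond i j ≡ G (f i) (f j)
    below 0F 1F _ = ~⇒≢ xy , sym xy
    below 0F 2F _ = ~⇒≢ xu , sym xu
    below 0F 3F _ = ~⇒≢ xw , sym xw
    below 1F 2F _ = ~⇒≢ yu , sym yu
    below 1F 3F _ = ~⇒≢ yw , sym yw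
    below 2F 3F _ = u≢w , sym uw
    below _ 0F ()
    below (suc _) 1F (s≤s ())
    below (suc (suc _)) 2F (s≤s (s≤s ()))
    below 3F 3F (s≤s (s≤s (s≤s ())))

  -- The edge `u w` is disjoint from the rest because each end sees the other but none of `a`, `b`,
  -- `c`.
  no-fork : ∀ {u w a b c} → u ~ w → u ≁ a → u ≁ b → u ≁ c → w ≁ a → w ≁ b → w ≁ c →
    a ≁ b → a ≁ c → b ≁ c → a ≢ b → a ≢ c → b ≢ c → ⊥
  no-fork {u} {w} {a} {b} {c} uw ua ub uc wa wb wc ab ac bc a≢b a≢c b≢c =
    fork-free (induced fork-sym
      (λ { 0F → refl ; 1F → refl ; 2F → refl ; 3F → refl ; 4F → refl }) simple f below)
    where
    f : Fin 5 → Fin n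
    f = a ◂ b ◂ c ◂ u ◂ w ◂ λ ()
    at-u : ∀ {v} → u ≁ v → w ≁ v → v ≢ u × false ≡ G v u
    at-u uv wv = ≢-sym (~≁⇒≢ (~-sym uw) wv) , sym (trans (G-sym _ _) uv)
    at-w : ∀ {v} → u ≁ v → w ≁ v → v ≢ w × false ≡ G v w
    at-w uv wv = ≢-sym (~≁⇒≢ uw uv) , sym (trans (G-sym _ _) wv)
    below : ∀ i j → i <ᶠ j → f i ≢ f j × 3P₁+P₂ i j ≡ G (f i) (f j)
    below 0F 1F _ = a≢b , sym ab
    below 0F 2F _ = a≢c , sym ac
    below 1F 2F _ = b≢c , sym bc
    below 0F 3F _ = at-u ua wa
    below 1F 3F _ = at-u ub wb
    below 2F 3F _ = at-u uc wc
    below 0F 4F _ = at-w ua wa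
    below 1F 4F _ = at-w ub wb
    below 2F 4F _ = at-w uc wc
    below 3F 4F _ = ~⇒≢ uw , sym uw
    below _ 0F ()
    below (suc _) 1F (s≤s ())
    below (suc (suc _)) 2F (s≤s (s≤s ()))
    below (suc (suc (suc _))) 3F (s≤s (s≤s (s≤s ())))
    below 4F 4F (s≤s (s≤s (s≤s (s≤s ()))))

  -- Ramsey's theorem, with cliques and independent sets treated alike.

  Homogeneous : Bool → List (Fin n) → Set
  Homogeneous c = AllPairs (λ x y → x ≢ y × G x y ≡ c)

  homogeneous-lookup : ∀ {c xs x y} → Homogeneous c xs → x ∈ xs → y ∈ xs → x ≢ y → G x y ≡ c
  homogeneous-lookup (_ ∷ _)  (here refl) (here refl) x≢y = contradiction refl x≢y
  homogeneous-lookup (p ∷ _)  (here refl) (there y∈)  _   = proj₂ (All.lookup p y∈)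
  homogeneous-lookup (p ∷ _)  (there x∈)  (here refl) _   = trans (G-sym _ _) (proj₂ (All.lookup p x∈))
  homogeneous-lookup (_ ∷ hs) (there x∈)  (there y∈)  x≢y = homogeneous-lookup hs x∈ y∈ x≢y

  HomogeneousIn : Bool → ℕ → List (Fin n) → Set
  HomogeneousIn c s xs =
    Σ (List (Fin n)) λ ys → length ys ≡ s × All (_∈ xs) ys × Homogeneous c ys

  homogeneousIn-∷ : ∀ {c s x xs ys} → All (x ≢_) xs → (∀ {y} → y ∈ ys → y ∈ xs × G x y ≡ c) →
    HomogeneousIn c s ys → HomogeneousIn c (suc s) (x ∷ xs)
  homogeneousIn-∷ {x = x} x≢ ys⊆ (zs , len , zs∈ , hom) =
    x ∷ zs , cong suc len , here refl ∷ All.map (there ∘ proj₁ ∘ ys⊆) zs∈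
    , All.map (λ z∈ → All.lookup x≢ (proj₁ (ys⊆ z∈)) , proj₂ (ys⊆ z∈)) zs∈ ∷ hom

  homogeneousIn-⊆ : ∀ {c s xs ys} → (∀ {y} → y ∈ ys → y ∈ xs) →
    HomogeneousIn c s ys → HomogeneousIn c s xs
  homogeneousIn-⊆ ys⊆ (zs , len , zs∈ , hom) = zs , len , All.map ys⊆ zs∈ , hom

  -- The first vertex has many neighbours or many non-neighbours among the rest. It extends a clique
  -- found in the former and an independent set found in the latter.
  ramsey : ∀ a b xs → AllPairs _≢_ xs → ramseyBound a b ≤ length xs →
    HomogeneousIn false a xs ⊎ HomogeneousIn true b xs
  ramsey zero    b       xs _ _ = inj₁ ([] , refl , [] , [])
  ramsey (suc a) zero    xs _ _ = inj₂ ([] , refl , [] , [])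
  ramsey (suc a) (suc b) (x ∷ xs) (x≢ ∷ uniq) (s≤s big) = split (ℕ.≤-total _ _)
    where
    nbr? : ∀ y → Dec (x ~ y)
    nbr? y = G x y Bool.≟ true
    nbrs non : List (Fin n)
    nbrs = filter nbr? xs
    non  = filter (¬? ∘ nbr?) xs
    nbrs⊆ : ∀ {y} → y ∈ nbrs → y ∈ xs × x ~ y
    nbrs⊆ = ∈-filter⁻ nbr?
    non⊆ : ∀ {y} → y ∈ non → y ∈ xs × x ≁ y
    non⊆ y∈ with ∈-filter⁻ (¬? ∘ nbr?) {xs = xs} y∈
    ... | y∈xs , ¬xy = y∈xs , ¬~⇒≁ ¬xy
    big′ : ramseyBound (suc a) b + ramseyBound a (suc b) ≤ length nbrs + length non
    big′ = subst (_ ≤_) (length-filter-¬? nbr? xs) big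
    split : ramseyBound (suc a) b ≤ length nbrs ⊎ length nbrs ≤ ramseyBound (suc a) b → _
    split (inj₁ le) with ramsey (suc a) b nbrs (AllPairs.filter⁺ nbr? uniq) le
    ... | inj₁ i = inj₁ (homogeneousIn-⊆ (there ∘ proj₁ ∘ nbrs⊆) i)
    ... | inj₂ c = inj₂ (homogeneousIn-∷ x≢ nbrs⊆ c)
    split (inj₂ ge) with ramsey a (suc b) non (AllPairs.filter⁺ (¬? ∘ nbr?) uniq)
                           (ℕ.+-cancelˡ-≤ (length nbrs) _ _
                             (ℕ.≤-trans (ℕ.+-monoˡ-≤ (ramseyBound a (suc b)) ge) big′))
    ... | inj₁ i = inj₁ (homogeneousIn-∷ x≢ non⊆ i)
    ... | inj₂ c = inj₂ (homogeneousIn-⊆ (there ∘ proj₁ ∘ non⊆) c)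

  -- A large independent set

  module LargeIndependent (I₀ : List (Fin n)) (hom : Homogeneous false I₀)
    (size : length I₀ ≡ 6) where

    -- These turn out to be the two sides of a bipartition, with `I₀` inside `I`.
    J I : Fin n → Set
    J v = Any.Any (v ~_) I₀
    I v = All (v ≁_) I₀

    J? : Decidable J
    J? v = Any.any? (λ a → G v a Bool.≟ true) I₀

    ¬J⇒I : ∀ {v} → ¬ J v → I v
    ¬J⇒I ¬j = All.map ¬~⇒≁ (¬Any⇒All¬ I₀ ¬j)

    I₀⊆I : ∀ {a} → a ∈ I₀ → I a
    I₀⊆I {a} a∈ = All.tabulate λ {b} b∈ → case a ≟ᶠ b of λ
      { (yes refl) → Simple.irrefl simple a ; (no a≢b) → homogeneous-lookup hom a∈ b∈ a≢b }

    -- An edge inside `I` and three vertices of `I₀` would induce `3P₁+P₂`.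
    independent-I : ∀ {u w} → I u → I w → u ≁ w
    independent-I iu iw = ¬~⇒≁ λ uw → three uw I₀ size hom iu iw
      where
      three : ∀ {u w} → u ~ w → ∀ xs → length xs ≡ 6 → Homogeneous false xs →
        All (u ≁_) xs → All (w ≁_) xs → ⊥
      three uw (_ ∷ _ ∷ _ ∷ _) _ (((a≢b , ab) ∷ (a≢c , ac) ∷ _) ∷ ((b≢c , bc) ∷ _) ∷ _)
        (ua ∷ ub ∷ uc ∷ _) (wa ∷ wb ∷ wc ∷ _) =
        no-fork uw ua ub uc wa wb wc ab ac bc a≢b a≢c b≢c

    -- A neighbour of `v` in `I₀` gives an edge which, with three missed vertices of `I`, would
    -- induce `3P₁+P₂`.
    J-misses≤2 : ∀ {v a b c} → J v → I a → I b → I c → v ≁ a → v ≁ b → v ≁ c →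
      a ≢ b → a ≢ c → b ≢ c → ⊥
    J-misses≤2 jv ia ib ic va vb vc with find jv
    ... | k , k∈ , vk = no-fork vk va vb vc
      (independent-I ik ia) (independent-I ik ib) (independent-I ik ic)
      (independent-I ia ib) (independent-I ia ic) (independent-I ib ic)
      where ik = I₀⊆I k∈

    -- Of the six vertices of `I₀`, `v` sees at least four, and `w` at least two of these. If `v`
    -- and `w` were adjacent, these two would complete a diamond.
    independent-J : ∀ {v w} → J v → J w → v ≁ w
    independent-J {v} {w} jv jw = ¬~⇒≁ λ vw →
      two vw common (AllPairs.filter⁺ (nbr? w) (AllPairs.filter⁺ (nbr? v) hom))
        (All.tabulate (λ x∈ → let x∈v , wx = ∈-filter⁻ (nbr? w) {xs = filter (nbr? v) I₀} x∈
                              in proj₂ (∈-filter⁻ (nbr? v) {xs = I₀} x∈v) , wx)) common≥2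
      where
      nbr? : ∀ v x → Dec (v ~ x)
      nbr? v x = G v x Bool.≟ true
      common = filter (nbr? w) (filter (nbr? v) I₀)
      restrict : ∀ {v m} xs → J v → All (_∈ I₀) xs → Homogeneous false xs →
        2 + m ≤ length xs → m ≤ length (filter (nbr? v) xs)
      restrict {v} {m} xs jv xs⊆ hxs big = ℕ.+-cancelˡ-≤ 2 _ _ (ℕ.≤-trans big
        (ℕ.≤-trans (ℕ.≤-reflexive (trans (length-filter-¬? (nbr? v) xs)
          (ℕ.+-comm (length (filter (nbr? v) xs)) _)))
          (ℕ.+-monoˡ-≤ (length (filter (nbr? v) xs))
            (length-filter≤2 (¬? ∘ nbr? v) {R = λ x y → x ≢ y × I x × I y} inI
              λ va vb vc (a≢b , ia , ib) (a≢c , _ , ic) (b≢c , _) →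
                J-misses≤2 jv ia ib ic (¬~⇒≁ va) (¬~⇒≁ vb) (¬~⇒≁ vc) a≢b a≢c b≢c))))
        where
        inI : AllPairs (λ x y → x ≢ y × I x × I y) xs
        inI = go xs⊆ hxs
          where
          go : ∀ {xs} → All (_∈ I₀) xs → Homogeneous false xs →
            AllPairs (λ x y → x ≢ y × I x × I y) xs
          go []         []       = []
          go (x∈ ∷ xs∈) (p ∷ hs) =
            All.zipWith (λ (y∈ , x≢y , _) → x≢y , I₀⊆I x∈ , I₀⊆I y∈) (xs∈ , p) ∷ go xs∈ hs
      common≥2 : 2 ≤ length common
      common≥2 = restrict (filter (nbr? v) I₀) jw
        (All.tabulate (proj₁ ∘ ∈-filter⁻ (nbr? v))) (AllPairs.filter⁺ (nbr? v) hom)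
        (restrict I₀ jv (All.tabulate λ x∈ → x∈) hom (ℕ.≤-reflexive (sym size)))
      two : v ~ w → ∀ xs → Homogeneous false xs → All (λ x → v ~ x × w ~ x) xs → 2 ≤ length xs → ⊥
      two vw (_ ∷ _ ∷ _) (((x≢y , xy) ∷ _) ∷ _) ((vx , wx) ∷ (vy , wy) ∷ _) _ =
        no-diamond vw vx vy wx wy xy x≢y
      two vw (_ ∷ []) _ _ (s≤s ())

    -- A vertex of I without neighbours in J gets a type of its own: it may miss many
    -- vertices of J.
    Attached : Fin n → Set
    Attached v = ∃ λ w → J w × v ~ w

    Attached? : Decidable Attached
    Attached? v = Fin.any? λ w → J? w ×-dec (G v w Bool.≟ true)

    -- The mirror image of `J-misses≤2`, with the edge supplied by `Attached`.
    I-misses≤2 : ∀ {v a b c} → I v → Attached v → J a → J b → J c → v ≁ a → v ≁ b → v ≁ c →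
      a ≢ b → a ≢ c → b ≢ c → ⊥
    I-misses≤2 iv (w , jw , vw) ja jb jc va vb vc = no-fork vw va vb vc
      (independent-J jw ja) (independent-J jw jb) (independent-J jw jc)
      (independent-J ja jb) (independent-J ja jc) (independent-J jb jc)

    data Type : Set where
      inJ attached isolated : Type

    type : Fin n → Type
    type v with J? v | Attached? v
    ... | yes _ | _     = inJ
    ... | no _  | yes _ = attached
    ... | no _  | no _  = isolated

    pattern-J : Type → Type → Bool
    pattern-J inJ      attached = true
    pattern-J attached inJ      = true
    pattern-J _        _        = false

    pattern-J-sym : ∀ a b → pattern-J a b ≡ pattern-J b a
    pattern-J-sym inJ inJ = refl
    pattern-J-sym inJ attached = refl
    pattern-J-sym inJ isolated = refl
    pattern-J-sym attached inJ = refl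
    pattern-J-sym attached attached = refl
    pattern-J-sym attached isolated = refl
    pattern-J-sym isolated inJ = refl
    pattern-J-sym isolated attached = refl
    pattern-J-sym isolated isolated = refl

    Miss : Fin n → Fin n → Set
    Miss v w = v ≁ w × ((J v × I w) ⊎ (I v × Attached v × J w))

    -- The pattern is exact inside `J`, inside `I` and at isolated vertices, so it fails only at a
    -- missing edge between `J` and an attached vertex.
    exceptional⇒Miss : ∀ v w → G v w ≢ pattern-J (type v) (type w) → Miss v w
    exceptional⇒Miss v w G≢ with J? v | Attached? v | J? w | Attached? w
    ... | yes jv | _      | yes jw | _      = contradiction (independent-J jv jw) G≢
    ... | yes jv | _      | no ¬jw | yes _  = ¬~⇒≁ G≢ , inj₁ (jv , ¬J⇒I ¬jw)
    ... | yes jv | _      | no ¬jw | no ¬aw =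
      contradiction (¬~⇒≁ λ vw → ¬aw (v , jv , ~-sym vw)) G≢
    ... | no ¬jv | yes av | yes jw | _      = ¬~⇒≁ G≢ , inj₂ (¬J⇒I ¬jv , av , jw)
    ... | no ¬jv | no ¬av | yes jw | _      = contradiction (¬~⇒≁ λ vw → ¬av (w , jw , vw)) G≢
    ... | no ¬jv | yes _  | no ¬jw | yes _  = contradiction (independent-I (¬J⇒I ¬jv) (¬J⇒I ¬jw)) G≢
    ... | no ¬jv | yes _  | no ¬jw | no _   = contradiction (independent-I (¬J⇒I ¬jv) (¬J⇒I ¬jw)) G≢
    ... | no ¬jv | no _   | no ¬jw | yes _  = contradiction (independent-I (¬J⇒I ¬jv) (¬J⇒I ¬jw)) G≢
    ... | no ¬jv | no _   | no ¬jw | no _   = contradiction (independent-I (¬J⇒I ¬jv) (¬J⇒I ¬jw)) G≢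

    J-I-disjoint : ∀ {v} → J v → I v → ⊥
    J-I-disjoint jv iv with find jv
    ... | _ , k∈ , vk = true≢false (trans (sym vk) (All.lookup iv k∈))

    misses≤2 : ∀ {v a b c} → Miss v a → Miss v b → Miss v c → a ≢ b → a ≢ c → b ≢ c → ⊥
    misses≤2 (va , inj₁ (jv , ia)) (vb , inj₁ (_ , ib)) (vc , inj₁ (_ , ic)) =
      J-misses≤2 jv ia ib ic va vb vc
    misses≤2 (va , inj₂ (iv , av , ja)) (vb , inj₂ (_ , _ , jb)) (vc , inj₂ (_ , _ , jc)) =
      I-misses≤2 iv av ja jb jc va vb vc
    misses≤2 (_ , inj₁ (jv , _)) (_ , inj₂ (iv , _)) _ = ⊥-elim (J-I-disjoint jv iv)
    misses≤2 (_ , inj₁ (jv , _)) _ (_ , inj₂ (iv , _)) = ⊥-elim (J-I-disjoint jv iv)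
    misses≤2 (_ , inj₂ (iv , _)) (_ , inj₁ (jv , _)) _ = ⊥-elim (J-I-disjoint jv iv)
    misses≤2 (_ , inj₂ (iv , _)) _ (_ , inj₁ (jv , _)) = ⊥-elim (J-I-disjoint jv iv)

    -- Eight codes for three types, so that the number of labels agrees with the clique case.
    code : Type → Fin 8
    code inJ      = 0F
    code attached = 1F
    code isolated = 2F

    code-injective : ∀ {a b} → code a ≡ code b → a ≡ b
    code-injective {inJ}      {inJ}      _ = refl
    code-injective {attached} {attached} _ = refl
    code-injective {isolated} {isolated} _ = refl

    bounded : ∀ r → CwAtMost ((r + 2 + 8) + (r + 2 + 8)) G
    bounded r = near-pattern⇒CwAtMost λ (_ , _ , _ , a) (_ , _ , _ , b) (_ , _ , _ , c) →
        misses≤2 (exceptional⇒Miss _ _ a) (exceptional⇒Miss _ _ b) (exceptional⇒Miss _ _ c)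
      where open NearPattern G simple code code-injective type pattern-J pattern-J-sym {r} [] z≤n

  -- Few large cliques

  -- Without diamonds a clique K with two vertices lies in a unique maximal clique,
  -- consisting of the vertices complete to the rest of K.
  record IsMaximalClique (C : Fin n → Set) : Set where
    field
      member?  : Decidable C
      complete : ∀ {x y} → C x → C y → x ≢ y → x ~ y
      unique-neighbour : ∀ {v x y} → ¬ C v → C x → C y → v ~ x → v ~ y → x ≢ y → ⊥

  Clique : Set₁
  Clique = Σ (Fin n → Set) IsMaximalClique

  -- A placeholder for cliques not yet found.
  ∅-clique : Clique
  ∅-clique = (λ _ → ⊥) , record
    { member? = λ _ → no λ () ; complete = λ () ; unique-neighbour = λ _ () }

  Span : List (Fin n) → Fin n → Set
  Span K v = All (λ k → v ≡ k ⊎ v ~ k) K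

  -- Two non-adjacent vertices of the span would form a diamond with two vertices of `K`. An outside
  -- vertex misses some `k` in `K`, and two neighbours of it in the span would form a diamond with
  -- both.
  span-clique : ∀ {K} → 2 ≤ length K → Homogeneous true K → IsMaximalClique (Span K)
  span-clique {K} big hom = record
    { member? = Span? ; complete = complete big hom ; unique-neighbour = unique }
    where
    Span? : Decidable (Span K)
    Span? v = All.all? (λ k → (v ≟ᶠ k) ⊎-dec (G v k Bool.≟ true)) K
    complete : ∀ {K} → 2 ≤ length K → Homogeneous true K →
      ∀ {x y} → Span K x → Span K y → x ≢ y → x ~ y
    complete {k₁ ∷ k₂ ∷ _} _ (((_ , kk) ∷ _) ∷ _) (x₁ ∷ x₂ ∷ _) (y₁ ∷ y₂ ∷ _) x≢y
      with x₁ | y₁ | x₂ | y₂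
    ... | inj₁ refl | inj₁ refl | _ | _ = contradiction refl x≢y
    ... | inj₁ refl | inj₂ yk   | _ | _ = ~-sym yk
    ... | inj₂ xk   | inj₁ refl | _ | _ = xk
    ... | inj₂ _    | inj₂ _    | inj₁ refl | inj₁ refl = contradiction refl x≢y
    ... | inj₂ _    | inj₂ _    | inj₁ refl | inj₂ yk   = ~-sym yk
    ... | inj₂ _    | inj₂ _    | inj₂ xk   | inj₁ refl = xk
    ... | inj₂ xk₁  | inj₂ yk₁  | inj₂ xk₂  | inj₂ yk₂  =
      decidable-stable (G _ _ Bool.≟ true) λ ¬xy →
        no-diamond kk (~-sym xk₁) (~-sym yk₁) (~-sym xk₂) (~-sym yk₂) (¬~⇒≁ ¬xy) x≢y
    complete {_ ∷ []} (s≤s ())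
    unique : ∀ {v x y} → ¬ Span K v → Span K x → Span K y → v ~ x → v ~ y → x ≢ y → ⊥
    unique {v} {x} {y} v∉ x∈ y∈ vx vy x≢y
      with find (¬All⇒Any¬ (λ k → (v ≟ᶠ k) ⊎-dec (G v k Bool.≟ true)) K v∉)
    ... | k , k∈ , ¬vk = no-diamond (complete big hom x∈ y∈ x≢y) (~-sym vx)
        (to-k x∈ vx) (~-sym vy) (to-k y∈ vy) (¬~⇒≁ (¬vk ∘ inj₂)) (¬vk ∘ inj₁)
      where
      to-k : ∀ {z} → Span K z → v ~ z → z ~ k
      to-k z∈ vz with All.lookup z∈ k∈
      ... | inj₁ refl = contradiction (inj₂ vz) ¬vk
      ... | inj₂ zk   = zk

  ⊆-Span : ∀ {K v} → Homogeneous true K → v ∈ K → Span K v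
  ⊆-Span {v = v} hom v∈ = All.tabulate λ {k} k∈ → case v ≟ᶠ k of λ
    { (yes v≡k) → inj₁ v≡k ; (no v≢k) → inj₂ (homogeneous-lookup hom v∈ k∈ v≢k) }

  -- Each vertex outside the span has at most one neighbour in it, so it costs at most one vertex of
  -- `K`.
  avoid : ∀ {K} → 2 ≤ length K → Homogeneous true K → ∀ us → All (λ u → ¬ Span K u) us →
    Σ (List (Fin n)) λ ys → All (λ y → y ∈ K × All (_≁ y) us) ys ×
      Homogeneous true ys × length K ≤ length us + length ys
  avoid {K} big hom [] _ = K , All.tabulate (λ y∈ → y∈ , []) , hom , ℕ.≤-refl
  avoid {K} big hom (u ∷ us) (u∉ ∷ us∉) with avoid big hom us us∉
  ... | ys , ys∈ , hom-ys , len = zs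
      , All.tabulate (λ z∈ → let z∈ys , uz = ∈-filter⁻ non? {xs = ys} z∈
                                 z∈K , us≁z = All.lookup ys∈ z∈ys
                             in z∈K , ¬~⇒≁ uz ∷ us≁z)
      , AllPairs.filter⁺ non? hom-ys
      , ℕ.≤-trans len (ℕ.≤-trans (ℕ.+-monoʳ-≤ (length us) ys≤) (ℕ.≤-reflexive (ℕ.+-suc _ _)))
    where
    nbr? : ∀ y → Dec (u ~ y)
    nbr? y = G u y Bool.≟ true
    non? = ¬? ∘ nbr?
    zs = filter non? ys
    in-span : ∀ {ys} → All (_∈ K) ys → Homogeneous true ys →
      AllPairs (λ x y → x ≢ y × Span K x × Span K y) ys
    in-span []         []       = []
    in-span (x∈ ∷ xs∈) (p ∷ hs) =
      All.zipWith (λ (y∈ , x≢y , _) → x≢y , ⊆-Span hom x∈ , ⊆-Span hom y∈) (xs∈ , p) ∷ in-span xs∈ hs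
    ys≤ : length ys ≤ suc (length zs)
    ys≤ = ℕ.≤-trans (ℕ.≤-reflexive (length-filter-¬? nbr? ys)) (ℕ.+-monoˡ-≤ (length zs)
      (length-filter≤1 nbr? (in-span (All.map proj₁ ys∈) hom-ys)
        λ ux uy (x≢y , x∈ , y∈) →
          IsMaximalClique.unique-neighbour (span-clique big hom) u∉ x∈ y∈ ux uy x≢y))

  -- Three maximal cliques covering almost all vertices.

  module ThreeCliques (cliques : Fin 3 → Clique) where

    C : Fin 3 → Fin n → Set
    C i = proj₁ (cliques i)

    module C i = IsMaximalClique (proj₂ (cliques i))

    Uncovered : Fin n → Set
    Uncovered v = ∀ i → ¬ C i v

    Uncovered? : Decidable Uncovered
    Uncovered? v = Fin.all? λ i → ¬? (C.member? i v)

    uncovered : List (Fin n)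
    uncovered = filter Uncovered? (allFin n)

    covered : ∀ {v} → v ∉ uncovered → ∃ λ i → C i v
    covered {v} v∉ = decidable-stable (Fin.any? λ i → C.member? i v) λ ¬∃ →
      v∉ (∈-filter⁺ Uncovered? (∈-allFin v) λ i v∈ → ¬∃ (i , v∈))

    Type : Set
    Type = Bool × Bool × Bool

    type : Fin n → Type
    type v = does (C.member? 0F v) , does (C.member? 1F v) , does (C.member? 2F v)

    meet : Type → Type → Bool
    meet (a₀ , a₁ , a₂) (b₀ , b₁ , b₂) = (a₀ ∧ b₀) ∨ ((a₁ ∧ b₁) ∨ (a₂ ∧ b₂))

    meet-sym : ∀ a b → meet a b ≡ meet b a
    meet-sym (a₀ , a₁ , a₂) (b₀ , b₁ , b₂) =
      cong₂ _∨_ (Bool.∧-comm a₀ b₀) (cong₂ _∨_ (Bool.∧-comm a₁ b₁) (Bool.∧-comm a₂ b₂))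

    -- Bracketed like `meet`, so that `does (Shared? v w)` computes to `meet (type v) (type w)`.
    Shared : Fin n → Fin n → Set
    Shared v w = (C 0F v × C 0F w) ⊎ ((C 1F v × C 1F w) ⊎ (C 2F v × C 2F w))

    Shared? : ∀ v w → Dec (Shared v w)
    Shared? v w = both 0F ⊎-dec (both 1F ⊎-dec both 2F)
      where
      both : ∀ i → Dec (C i v × C i w)
      both i = C.member? i v ×-dec C.member? i w

    shared : ∀ i {v w} → C i v → C i w → Shared v w
    shared 0F v∈ w∈ = inj₁ (v∈ , w∈)
    shared 1F v∈ w∈ = inj₂ (inj₁ (v∈ , w∈))
    shared 2F v∈ w∈ = inj₂ (inj₂ (v∈ , w∈))

    shared⇒~ : ∀ {v w} → Shared v w → v ≢ w → v ~ w
    shared⇒~ (inj₁ (v∈ , w∈))        = C.complete 0F v∈ w∈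
    shared⇒~ (inj₂ (inj₁ (v∈ , w∈))) = C.complete 1F v∈ w∈
    shared⇒~ (inj₂ (inj₂ (v∈ , w∈))) = C.complete 2F v∈ w∈

    bit : Bool → Fin 2
    bit false = 0F
    bit true  = 1F

    bit-injective : ∀ {a b} → bit a ≡ bit b → a ≡ b
    bit-injective {false} {false} _ = refl
    bit-injective {true}  {true}  _ = refl

    code : Type → Fin 8
    code (a , b , c) = combine (bit a) (combine (bit b) (bit c))

    code-injective : ∀ {a b} → code a ≡ code b → a ≡ b
    code-injective eq with Fin.combine-injective _ _ _ _ eq
    ... | eq₀ , eq′ with Fin.combine-injective _ _ _ _ eq′
    ...   | eq₁ , eq₂ =
      cong₂ _,_ (bit-injective eq₀) (cong₂ _,_ (bit-injective eq₁) (bit-injective eq₂))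

    Cross : Fin n → Fin n → Set
    Cross v w = v ~ w × ∃ λ i → C i w × ¬ C i v

    -- Sharing a clique forces the edge that the pattern predicts. So an exceptional pair is an edge
    -- without a common clique, and the clique covering `w` misses `v`.
    exceptional⇒Cross : ∀ {v w} → w ∉ uncovered → v ≢ w →
      G v w ≢ meet (type v) (type w) → Cross v w
    exceptional⇒Cross {v} {w} w∉ v≢w G≢ with Shared? v w in eq
    ... | yes s = contradiction (trans (shared⇒~ s v≢w) (sym (cong does eq))) G≢
    ... | no ¬s with covered w∉
    ...   | i , w∈ = Bool.¬-not (λ G≡ → G≢ (trans G≡ (sym (cong does eq))))
                   , i , w∈ , λ v∈ → ¬s (shared i v∈ w∈)

    -- Three indices in the two-element complement of `i`.
    agree : ∀ {i a b c : Fin 3} → i ≢ a → i ≢ b → i ≢ c → a ≡ b ⊎ a ≡ c ⊎ b ≡ c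
    agree {i} i≢a i≢b i≢c with Fin.pigeonhole (s≤s (s≤s (s≤s z≤n))) others
      where
      others : Fin 3 → Fin 2
      others = punchOut i≢a ◂ punchOut i≢b ◂ punchOut i≢c ◂ λ ()
    ... | 0F , 1F , _ , eq = inj₁ (Fin.punchOut-injective i≢a i≢b eq)
    ... | 0F , 2F , _ , eq = inj₂ (inj₁ (Fin.punchOut-injective i≢a i≢c eq))
    ... | 1F , 2F , _ , eq = inj₂ (inj₂ (Fin.punchOut-injective i≢b i≢c eq))
    ... | _ , 0F , () , _
    ... | suc _ , 1F , s≤s () , _
    ... | suc (suc _) , 2F , s≤s (s≤s ()) , _

    -- v lies in one of the three cliques, so its cross neighbours lie in the other two.
    crosses≤2 : ∀ {v a b c} → v ∉ uncovered → Cross v a → Cross v b → Cross v c →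
      a ≢ b → a ≢ c → b ≢ c → ⊥
    crosses≤2 {v} v∉ (va , i , a∈ , v∉i) (vb , j , b∈ , v∉j) (vc , k , c∈ , v∉k) a≢b a≢c b≢c
      with covered v∉
    ... | h , v∈ with agree (apart v∉i) (apart v∉j) (apart v∉k)
      where
      apart : ∀ {l} → ¬ C l v → h ≢ l
      apart v∉l refl = v∉l v∈
    ... | inj₁ refl        = C.unique-neighbour i v∉i a∈ b∈ va vb a≢b
    ... | inj₂ (inj₁ refl) = C.unique-neighbour i v∉i a∈ c∈ va vc a≢c
    ... | inj₂ (inj₂ refl) = C.unique-neighbour j v∉j b∈ c∈ vb vc b≢c

    bounded : ∀ r → length uncovered ≤ r → CwAtMost ((r + 2 + 8) + (r + 2 + 8)) G
    bounded r short = near-pattern⇒CwAtMost λ a b c → crosses≤2 (proj₁ a) (cross a) (cross b) (cross c)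
      where
      open NearPattern G simple code code-injective type meet meet-sym uncovered short
      cross : ∀ {v w} → Exc v w → Cross v w
      cross (_ , w∉ , v≢w , G≢) = exceptional⇒Cross w∉ v≢w G≢

  -- Collecting disjoint 5-cliques.

  LargeClique : Set
  LargeClique = Σ (List (Fin n)) λ K → length K ≡ 5 × Homogeneous true K

  span : LargeClique → Clique
  span (K , len , hom) = Span K , span-clique (subst (2 ≤_) (sym len) (s≤s (s≤s z≤n))) hom

  Apart : Clique → LargeClique → Set
  Apart c (K , _) = All (λ v → ¬ proj₁ c v) K

  nonempty : ∀ {A : Set} (xs : List A) → 1 ≤ length xs → ∃ (_∈ xs)
  nonempty (x ∷ _) _ = x , here refl

  -- Later cliques avoid the spans of earlier ones, so vertices are picked from the last clique
  -- backwards, each non-adjacent to those before. Three picks exclude at most three of the five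
  -- vertices of `K₁`, and the remaining two form the edge of `3P₁+P₂`.
  no-four-cliques : (K₁ K₂ K₃ K₄ : LargeClique) →
    Apart (span K₁) K₂ → Apart (span K₁) K₃ → Apart (span K₁) K₄ →
    Apart (span K₂) K₃ → Apart (span K₂) K₄ → Apart (span K₃) K₄ → ⊥
  no-four-cliques (K₁ , len₁ , hom₁) (K₂ , len₂ , hom₂) (K₃ , len₃ , hom₃) (K₄ , len₄ , hom₄)
    d₁₂ d₁₃ d₁₄ d₂₃ d₂₄ d₃₄ =
    pick₄ (nonempty K₄ (subst (1 ≤_) (sym len₄) (s≤s z≤n)))
    where
    two≤ : ∀ (K : List (Fin n)) → length K ≡ 5 → 2 ≤ length K
    two≤ K len = subst (2 ≤_) (sym len) (s≤s (s≤s z≤n))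
    spare : ∀ m {l} (K : List (Fin n)) → length K ≡ 5 → length K ≤ m + l → 5 ≤ m + l
    spare m K len le = subst (_≤ _) len le
    distinct : ∀ {K x y} → Homogeneous true K → x ∈ K → ¬ Span K y → x ≢ y
    distinct hom x∈ y∉ refl = y∉ (⊆-Span hom x∈)

    pick₁ : ∀ {k₂ k₃ k₄} → k₂ ∈ K₂ → k₃ ∈ K₃ → k₄ ∈ K₄ → k₃ ≁ k₂ → k₄ ≁ k₂ → k₄ ≁ k₃ → ⊥
    pick₁ {k₂} {k₃} {k₄} k₂∈ k₃∈ k₄∈ n₃₂ n₄₂ n₄₃
      with avoid (two≤ K₁ len₁) hom₁ (k₂ ∷ k₃ ∷ k₄ ∷ [])
             (All.lookup d₁₂ k₂∈ ∷ All.lookup d₁₃ k₃∈ ∷ All.lookup d₁₄ k₄∈ ∷ [])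
    ... | ys , ys∈ , hom , le = fork ys ys∈ hom (ℕ.+-cancelˡ-≤ 3 _ _ (spare 3 K₁ len₁ le))
      where
      fork : ∀ ys → All (λ y → y ∈ K₁ × All (_≁ y) (k₂ ∷ k₃ ∷ k₄ ∷ [])) ys →
        Homogeneous true ys → 2 ≤ length ys → ⊥
      fork (_ ∷ []) _ _ (s≤s ())
      fork (u ∷ w ∷ _) ((_ , u₂ ∷ u₃ ∷ u₄ ∷ []) ∷ (_ , w₂ ∷ w₃ ∷ w₄ ∷ []) ∷ _)
        (((_ , uw) ∷ _) ∷ _) _ =
        no-fork uw (≁-sym u₂) (≁-sym u₃) (≁-sym u₄) (≁-sym w₂) (≁-sym w₃) (≁-sym w₄)
          (≁-sym n₃₂) (≁-sym n₄₂) (≁-sym n₄₃)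
          (distinct hom₂ k₂∈ (All.lookup d₂₃ k₃∈)) (distinct hom₂ k₂∈ (All.lookup d₂₄ k₄∈))
          (distinct hom₃ k₃∈ (All.lookup d₃₄ k₄∈))

    pick₂ : ∀ {k₃ k₄} → k₃ ∈ K₃ → k₄ ∈ K₄ → k₄ ≁ k₃ → ⊥
    pick₂ {k₃} {k₄} k₃∈ k₄∈ n₄₃
      with avoid (two≤ K₂ len₂) hom₂ (k₃ ∷ k₄ ∷ []) (All.lookup d₂₃ k₃∈ ∷ All.lookup d₂₄ k₄∈ ∷ [])
    ... | ys , ys∈ , _ , le
      with nonempty ys (ℕ.≤-trans (s≤s z≤n) (ℕ.+-cancelˡ-≤ 2 3 _ (spare 2 K₂ len₂ le)))
    ... | k₂ , k₂∈ with All.lookup ys∈ k₂∈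
    ...   | k₂∈K , n₃₂ ∷ n₄₂ ∷ [] = pick₁ k₂∈K k₃∈ k₄∈ n₃₂ n₄₂ n₄₃

    pick₃ : ∀ {k₄} → k₄ ∈ K₄ → ⊥
    pick₃ {k₄} k₄∈ with avoid (two≤ K₃ len₃) hom₃ (k₄ ∷ []) (All.lookup d₃₄ k₄∈ ∷ [])
    ... | ys , ys∈ , _ , le
      with nonempty ys (ℕ.≤-trans (s≤s z≤n) (ℕ.+-cancelˡ-≤ 1 4 _ (spare 1 K₃ len₃ le)))
    ... | k₃ , k₃∈ with All.lookup ys∈ k₃∈
    ...   | k₃∈K , n₄₃ ∷ [] = pick₂ k₃∈K k₄∈ n₄₃

    pick₄ : ∃ (_∈ K₄) → ⊥
    pick₄ (_ , k₄∈) = pick₃ k₄∈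

  module _ (r : ℕ) (ramsey≤r : ramseyBound 6 5 ≤ r) where

    Bounded : Set
    Bounded = CwAtMost ((r + 2 + 8) + (r + 2 + 8)) G

    -- If too many vertices are uncovered, Ramsey's theorem applies among them: an independent 6-set
    -- settles the matter at once, a 5-clique is handed on.
    search : (cliques : Fin 3 → Clique) →
      Bounded ⊎ Σ LargeClique λ K → ∀ i → Apart (cliques i) K
    search cliques with length uncovered ℕ.≤? r
      where open ThreeCliques cliques
    ... | yes short = inj₁ (ThreeCliques.bounded cliques r short)
    ... | no ¬short with ramsey 6 5 uncovered (AllPairs.filter⁺ Uncovered? (allFin⁺ n))
                           (ℕ.≤-trans ramsey≤r (ℕ.≰⇒≥ ¬short))
      where open ThreeCliques cliques
    ...   | inj₁ (I₀ , len , _ , hom)  = inj₁ (LargeIndependent.bounded I₀ hom len r)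
    ...   | inj₂ (K , len , K⊆ , hom)  = inj₂ ((K , len , hom) ,
      λ i → All.map (λ v∈ → proj₂ (∈-filter⁻ Uncovered? {xs = allFin n} v∈) i) K⊆)
      where open ThreeCliques cliques

    bounded : Bounded
    bounded with search (∅-clique ◂ ∅-clique ◂ ∅-clique ◂ λ ())
    ... | inj₁ b = b
    ... | inj₂ (K₁ , _) with search (span K₁ ◂ ∅-clique ◂ ∅-clique ◂ λ ())
    ...   | inj₁ b = b
    ...   | inj₂ (K₂ , d₂) with search (span K₁ ◂ span K₂ ◂ ∅-clique ◂ λ ())
    ...     | inj₁ b = b
    ...     | inj₂ (K₃ , d₃) with search (span K₁ ◂ span K₂ ◂ span K₃ ◂ λ ())
    ...       | inj₁ b = b
    ...       | inj₂ (K₄ , d₄) =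
      ⊥-elim (no-four-cliques K₁ K₂ K₃ K₄ (d₂ 0F) (d₃ 0F) (d₄ 0F) (d₃ 1F) (d₄ 1F) (d₄ 2F))

theorem1 : Σ ℕ λ c → ∀ (n : ℕ) (G : Graph n) → Simple G →
    Free diamond G → Free 3P₁+P₂ G → CwAtMost c G
-- `r` uncovered vertices, two ends of cut edges and eight types, doubled for the scratch labels.
theorem1 = (r + 2 + 8) + (r + 2 + 8) , λ n G simple diamond-free fork-free →
    Forbidden.bounded G simple diamond-free fork-free r ℕ.≤-refl
  where r = ramseyBound 6 5
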